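{- The logics $\vdash_{[a}$ (for $a\in(0,1]$) and $\vdash_{(a}$ (for $a\in[0,1)$), defined by the order filters $[a,1]$ and $(a,1]$ over the standard $\mathrm G_\sim$-algebra $[0,1]_{\mathrm G_\sim}$, and their finitary companions $\vdash^f_{[a}$, $\vdash^f_{(a}$, satisfy (with $\vdash_1$ denoting $\vdash_{[1}$): P1. $\vdash_{[p}\;=\;\vdash_{[p'}$ and $\vdash_{(p}\;=\;\vdash_{(p'}$ for all $p,p'\in(1/2,1)$. Moreover $\vdash_{(p}\;\subseteq\;\vdash_{[p}$ and $\vdash^f_{[p}\;=\;\vdash^f_{(p}$ for all $p\in(1/2,1)$. P2. $\vdash_{[n}\;=\;\vdash_{[n'}$ and $\vdash_{(n}\;=\;\vdash_{(n'}$ for all $n,n'\in(0,1/2)$. Moreover $\vdash_{(n}\;\subseteq\;\vdash_{[n}$ and $\vdash^f_{[n}\;=\;\vdash^f_{(n}$ for all $n\in(0,1/2)$. P3. $\vdash_{[p}\;\subsetneq\;\vdash_1$ for any $p\in(1/2,1)$. P4. $\vdash_1$ and $\vdash_{[1/2}$ are not comparable. P5. $\vdash_{[p}$ and $\vdash_{[1/2}$, as well as $\vdash^f_{[p}$ and $\vdash_{[1/2}$, are not comparable, for any $p\in(1/2,1)$. P6. $\vdash^f_{[p}\;\subsetneq\;\vdash_{(1/2}$ for any $p\in(1/2,1)$. P7. $\vdash_{[p}$ and $\vdash_{[n}$ are not comparable, for any $p\in(1/2,1)$ and any $n\in(0,1/2)$; the same holds for $\vdash^f_{[p}$ and $\vdash^f_{[n}$.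 P8. $\vdash_{[n}\;\subsetneq\;\vdash_{[1/2}$ for any $n\in(0,1/2)$. P9. $\vdash_{(0}$, $\vdash_{[1/2}$ and $\vdash_{(1/2}$ are pairwise incomparable. P10. $\vdash^f_{[n}\;\subsetneq\;\vdash_{(0}$ for any $n\in(0,1/2)$.
   Context: **Language.** Formulas are built from countably many propositional variables, the constant $\bot$, the binary connectives $\wedge,\to$ and the unary connective $\sim$. Abbreviations: $\neg\varphi:=\varphi\to\bot$, $\Delta\varphi:=\neg\sim\varphi$. **Algebra.** $[0,1]_{\mathrm G_\sim}$ is the algebra on the real interval $[0,1]$ with $\wedge=\min$, $x\to y=1$ if $x\le y$ and $x\to y=y$ otherwise, $\sim x=1-x$, $\bot=0$. **Logics.** Put $F_{[a}=\{x\in[0,1]:x\ge a\}$ for $a\in(0,1]$ and $F_{(a}=\{x\in[0,1]:x>a\}$ for $a\in[0,1)$. For arbitrary (possibly infinite) $\Gamma$, $\Gamma\vdash_{[a}\varphi$ (resp. $\Gamma\vdash_{(a}\varphi$) iff for every evaluation $e$ on $[0,1]_{\mathrm G_\sim}$, if $e(\gamma)\in F$ for all $\gamma\in\Gamma$ then $e(\varphi)\in F$, where $F=F_{[a}$ (resp. $F=F_{(a}$). The finitary companion $\vdash^f$ of $\vdash$ is: $\Gamma\vdash^f\varphi$ iff $\Gamma_0\vdash\varphi$ for some finite $\Gamma_0\subseteq\Gamma$. Inclusion and comparability refer to inclusion of consequence relations. -}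

module Defs where

open import Axiom.ExcludedMiddle using (ExcludedMiddle)
open import Data.Bool.Base using (if_then_else_)
open import Data.Empty using (⊥-elim)
open import Data.List.Membership.Propositional using () renaming (_∈_ to _∈ˡ_)
open import Data.List.Relation.Unary.All using (All)
open import Data.Nat.Base using (ℕ)
open import Data.Product.Base using (_×_; _,_; ∃; ∃-syntax)
open import Data.Rational using (ℚ; 0ℚ; 1ℚ; ½; _+_; _-_; -_)
  renaming (_≤_ to _≤ℚ_; _<_ to _<ℚ_)
open import Data.Rational.Properties as ℚₚ
open import Data.Sum.Base using (_⊎_; inj₁; inj₂; swap)
open import Level using (0ℓ) renaming (suc to lsuc)
open import Relation.Binary.PropositionalEquality
open import Relation.Nullary using (¬_; yes; no; does)
open import Relation.Unary using (Pred; _∈_; _⊈_)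

------------------------------------------------------------------------
-- Real numbers as two-sided Dedekind cuts of ℚ

record ℝ : Set₁ where
  field
    L U         : Pred ℚ 0ℓ
    L-inhabited : ∃ L
    U-inhabited : ∃ U
    L-down      : ∀ {q r} → q <ℚ r → L r → L q
    L-open      : ∀ {q} → L q → ∃[ r ] q <ℚ r × L r
    U-up        : ∀ {q r} → q <ℚ r → U q → U r
    U-open      : ∀ {r} → U r → ∃[ q ] q <ℚ r × U q
    disjoint    : ∀ {q} → ¬ (L q × U q)
    located     : ∀ {q r} → q <ℚ r → L q ⊎ U r

open ℝ

infix 4 _≤_ _<_

-- Equality of reals is x ≤ y × y ≤ x, not _≡_.
_≤_ : ℝ → ℝ → Set
x ≤ y = ∀ q → L x q → L y q

_<_ : ℝ → ℝ → Set
x < y = ∃[ q ] U x q × L y q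

⦅_,_⦆ : ℝ → ℝ → Pred ℝ 0ℓ
⦅ a , b ⦆ x = a < x × x < b

1-anti : ∀ {q r} → q <ℚ r → 1ℚ - r <ℚ 1ℚ - q
1-anti q<r = +-monoʳ-< 1ℚ (neg-antimono-< q<r)

1-invol : ∀ q → 1ℚ - (1ℚ - q) ≡ q
1-invol q = begin
  1ℚ + - (1ℚ + - q)       ≡⟨ cong (1ℚ +_) (neg-distrib-+ 1ℚ (- q)) ⟩
  1ℚ + (- 1ℚ + - (- q))   ≡⟨ +-assoc 1ℚ (- 1ℚ) (- (- q)) ⟨
  0ℚ + - (- q)            ≡⟨ +-identityˡ (- (- q)) ⟩
  - (- q)                 ≡⟨ ⁻¹-involutive q ⟩
  q                       ∎
  where
  open ≡-Reasoning
  open import Algebra.Properties.Group +-0-group using (⁻¹-involutive)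

q-1<q : ∀ q → q - 1ℚ <ℚ q
q-1<q q = subst (q - 1ℚ <ℚ_) (+-identityʳ q)
  (+-monoʳ-< q (neg-antimono-< (positive⁻¹ 1ℚ)))

q<q+1 : ∀ q → q <ℚ q + 1ℚ
q<q+1 q = subst (_<ℚ q + 1ℚ) (+-identityʳ q) (+-monoʳ-< q (positive⁻¹ 1ℚ))

fromℚ : ℚ → ℝ
fromℚ p = record
  { L           = _<ℚ p
  ; U           = p <ℚ_
  ; L-inhabited = p - 1ℚ , q-1<q p
  ; U-inhabited = p + 1ℚ , q<q+1 p
  ; L-down      = <-trans
  ; L-open      = λ q<p → let r , q<r , r<p = <-dense q<p in r , q<r , r<p
  ; U-up        = λ q<r p<q → <-trans p<q q<r
  ; U-open      = λ p<r → let q , p<q , q<r = <-dense p<r in q , q<r , p<q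
  ; disjoint    = λ (q<p , p<q) → <-asym q<p p<q
  ; located     = loc
  }
  where
  loc : ∀ {q r} → q <ℚ r → q <ℚ p ⊎ p <ℚ r
  loc {q} q<r with q ℚₚ.<? p
  ... | yes q<p = inj₁ q<p
  ... | no  q≮p = inj₂ (≤-<-trans (≮⇒≥ q≮p) q<r)

0ℝ ½ℝ 1ℝ : ℝ
0ℝ = fromℚ 0ℚ
½ℝ = fromℚ ½
1ℝ = fromℚ 1ℚ

-- q < 1 - x iff x < 1 - q, and symmetrically for the upper cut.
1-_ : ℝ → ℝ
1- x = record
  { L           = λ q → U x (1ℚ - q)
  ; U           = λ q → L x (1ℚ - q)
  ; L-inhabited = let q , Uq = U-inhabited x in 1ℚ - q , subst (U x) (sym (1-invol q)) Uq
  ; U-inhabited = let q , Lq = L-inhabited x in 1ℚ - q , subst (L x) (sym (1-invol q)) Lq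
  ; L-down      = λ q<r → U-up x (1-anti q<r)
  ; L-open      = λ {q} Uq → let r , r< , Ur = U-open x Uq in
      1ℚ - r , subst (_<ℚ 1ℚ - r) (1-invol q) (1-anti r<) , subst (U x) (sym (1-invol r)) Ur
  ; U-up        = λ q<r → L-down x (1-anti q<r)
  ; U-open      = λ {q} Lq → let r , <r , Lr = L-open x Lq in
      1ℚ - r , subst (1ℚ - r <ℚ_) (1-invol q) (1-anti <r) , subst (L x) (sym (1-invol r)) Lr
  ; disjoint    = λ (Uq , Lq) → disjoint x (Lq , Uq)
  ; located     = λ q<r → swap (located x (1-anti q<r))
  }

------------------------------------------------------------------------
-- The real unit interval

record 𝕀 : Set₁ where
  constructor mk𝕀
  field
    val   : ℝ
    0≤val : 0ℝ ≤ val
    val≤1 : val ≤ 1ℝ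

open 𝕀

0≤1 : 0ℝ ≤ 1ℝ
0≤1 q q<0 = <-trans q<0 (positive⁻¹ 1ℚ)

0≤1-x : ∀ x → x ≤ 1ℝ → 0ℝ ≤ 1- x
0≤1-x x x≤1 q q<0 with located x (1-anti q<0)
... | inj₁ L1 = ⊥-elim (<-irrefl refl (x≤1 1ℚ L1))
... | inj₂ Uq = Uq

1-x≤1 : ∀ x → 0ℝ ≤ x → 1- x ≤ 1ℝ
1-x≤1 x 0≤x q Uq with q ℚₚ.<? 1ℚ
... | yes q<1 = q<1
... | no  q≮1 =
  let r , r<1-q , Ur = U-open x Uq
      1-q≤0 = +-monoʳ-≤ 1ℚ (neg-antimono-≤ (≮⇒≥ q≮1))
  in ⊥-elim (disjoint x (0≤x r (<-≤-trans r<1-q 1-q≤0) , Ur))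

𝕀-zero 𝕀-one : 𝕀
𝕀-zero = mk𝕀 0ℝ (λ _ q<0 → q<0) 0≤1
𝕀-one  = mk𝕀 1ℝ 0≤1 (λ _ q<1 → q<1)

𝕀-neg : 𝕀 → 𝕀
𝕀-neg x = mk𝕀 (1- val x) (0≤1-x (val x) (val≤1 x)) (1-x≤1 (val x) (0≤val x))

[_,1] : ℝ → Pred 𝕀 0ℓ
[ a ,1] x = a ≤ val x

⦅_,1] : ℝ → Pred 𝕀 0ℓ
⦅ a ,1] x = a < val x

------------------------------------------------------------------------
-- Formulas

infixr 7 _∧̇_
infixr 6 _→̇_
infix  8 ∼̇_

data Fm : Set where
  var  : ℕ → Fm
  ⊥̇    : Fm
  _∧̇_  : Fm → Fm → Fm
  _→̇_  : Fm → Fm → Fm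
  ∼̇_   : Fm → Fm

------------------------------------------------------------------------
-- Consequence relations, as sets of pairs (Γ , φ)

Logic : Set₂
Logic = Pred (Pred Fm 0ℓ × Fm) (lsuc 0ℓ)

-- Finite sets of formulas are represented by lists.
infix 25 _ᶠ
_ᶠ : Logic → Logic
(⊢ ᶠ) (Γ , φ) = ∃[ Γ₀ ] All (_∈ Γ) Γ₀ × ((_∈ˡ Γ₀) , φ) ∈ ⊢

Incomparable : Logic → Logic → Set₁
Incomparable ⊢ ⊢′ = ⊢ ⊈ ⊢′ × ⊢′ ⊈ ⊢

------------------------------------------------------------------------
-- The algebra [0,1] with its evaluations, and the logics of its order
-- filters. Excluded middle supplies the case distinction x ≤ y, which
-- is not decidable constructively.

module StandardAlgebra (em : ExcludedMiddle 0ℓ) where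

  infixr 7 _⊓_
  infixr 6 _⇒_

  _⊓_ : 𝕀 → 𝕀 → 𝕀
  x ⊓ y = if does (em {val x ≤ val y}) then x else y

  _⇒_ : 𝕀 → 𝕀 → 𝕀
  x ⇒ y = if does (em {val x ≤ val y}) then 𝕀-one else y

  ⟦_⟧ : Fm → (ℕ → 𝕀) → 𝕀
  ⟦ var i ⟧   v = v i
  ⟦ ⊥̇ ⟧       v = 𝕀-zero
  ⟦ φ ∧̇ ψ ⟧   v = ⟦ φ ⟧ v ⊓ ⟦ ψ ⟧ v
  ⟦ φ →̇ ψ ⟧   v = ⟦ φ ⟧ v ⇒ ⟦ ψ ⟧ v
  ⟦ ∼̇ φ ⟧     v = 𝕀-neg (⟦ φ ⟧ v)

  logicOf : Pred 𝕀 0ℓ → Logic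
  logicOf F (Γ , φ) = (v : ℕ → 𝕀) → (∀ {γ} → γ ∈ Γ → ⟦ γ ⟧ v ∈ F) → ⟦ φ ⟧ v ∈ F

  infix 30 ⊢[_ ⊢⦅_

  ⊢[_ : ℝ → Logic
  ⊢[ a = logicOf [ a ,1]

  ⊢⦅_ : ℝ → Logic
  ⊢⦅ a = logicOf ⦅ a ,1]

  ⊢₁ : Logic
  ⊢₁ = ⊢[ 1ℝ

{-# OPTIONS --safe #-}
module Submission where

-- A strictly increasing f : [0,1] → [0,1], not necessarily continuous, with
-- f 1 = 1 and f (1 - x) = 1 - f x is an embedding of algebras. Some such f
-- sends p to p′ whenever ½ < p , p′ < 1: on [½,1], contract the part below p
-- into [½,p′) and the part above p into (p′,1] by affine maps with rational
-- coefficients. By symmetry the same holds in (0,½), so within each of these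
-- intervals the threshold is irrelevant. The inclusions follow by choosing,
-- for a countermodel, a threshold strictly between the values of the
-- conclusion and of the premises; in the passage from [a,1] to (b,1] this
-- needs the premises to be finitely many. Six sequents in one variable
-- give all the non-inclusions.

open import Defs
open import Axiom.ExcludedMiddle using (ExcludedMiddle)
open import Data.Bool.Base using (if_then_else_)
open import Data.Empty using (⊥-elim)
open import Data.List.Base using (List; []; _∷_)
open import Data.List.Membership.Propositional using () renaming (_∈_ to _∈ˡ_)
open import Data.List.Relation.Unary.All as All using (All; []; _∷_)
open import Data.List.Relation.Unary.Any using (here)
open import Data.Nat.Base using (ℕ)
open import Data.Product.Base using (Σ; ∃-syntax; _×_; _,_; proj₁; proj₂)
open import Data.Rational using (ℚ; 0ℚ; 1ℚ; ½; _+_; _*_; _-_; -_; 1/_; Positive; positive)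
  renaming (_<_ to _<ℚ_)
import Data.Rational.Properties as ℚ
open import Data.Rational.Solver using (module +-*-Solver)
open import Data.Sum.Base using ([_,_]′)
open import Function.Base using (id; _∘_; const; case_of_)
open import Level using (0ℓ)
open import Relation.Binary.Definitions using (tri<; tri≈; tri>)
open import Relation.Binary.PropositionalEquality
open import Relation.Nullary using (¬_; Dec; yes; no; does)
open import Relation.Nullary.Decidable using (dec-true; dec-false; decidable-stable; from-yes)
open import Relation.Unary using (Pred; _∈_; _∉_; _⊆_; _⊆′_; _⊈_; _⊂_; _≐_; _∩_; ∁; U)

open ℝ renaming (U to Up)
open 𝕀

-- Order of the Dedekind reals.

L<U : ∀ x {q r} → L x q → Up x r → q <ℚ r
L<U x {q} {r} Lq Ur with ℚ.<-cmp q r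
... | tri< q<r _ _   = q<r
... | tri≈ _ refl _  = ⊥-elim (disjoint x (Lq , Ur))
... | tri> _ _ r<q   = ⊥-elim (disjoint x (L-down x r<q Lq , Ur))

-- The order is defined through lower cuts alone. Locatedness of `x` carries it over to upper cuts,
-- which is what makes `1-_` antitone.
U-antitone : ∀ x y → x ≤ y → ∀ {q} → Up y q → Up x q
U-antitone x y x≤y Uq =
  let r , r<q , Ur = U-open y Uq
  in [ (λ Lr → ⊥-elim (disjoint y (x≤y r Lr , Ur))) , id ]′ (located x r<q)

-- Records around _≤_ and _<_: those unfold, so that their arguments
-- could not be inferred. Comparing rational reals likewise unfolds their
-- cuts, hence hypotheses of the form x ≡ fromℚ q below.
infix 4 _⊑_ _⊏_ _≈_

record _⊑_ (x y : ℝ) : Set where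
  constructor ⊑-in
  field ⊑-out : x ≤ y

record _⊏_ (x y : ℝ) : Set where
  constructor ⊏-in
  field ⊏-out : x < y

open _⊑_
open _⊏_

_≈_ : ℝ → ℝ → Set
x ≈ y = x ⊑ y × y ⊑ x

private variable
  x y z : ℝ

⊑-refl : x ⊑ x
⊑-refl = ⊑-in λ _ → id

⊑-trans : x ⊑ y → y ⊑ z → x ⊑ z
⊑-trans (⊑-in p) (⊑-in q) = ⊑-in λ r → q r ∘ p r

≈-refl : x ≈ x
≈-refl = ⊑-refl , ⊑-refl

≈-sym : x ≈ y → y ≈ x
≈-sym (p , q) = q , p

≈-trans : x ≈ y → y ≈ z → x ≈ z
≈-trans (p , q) (p′ , q′) = ⊑-trans p p′ , ⊑-trans q′ q

⊏⇒⊑ : x ⊏ y → x ⊑ y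
⊏⇒⊑ {x} {y} (⊏-in (q , Uq , Lq)) = ⊑-in λ r Lr → L-down y (L<U x Lr Uq) Lq

⊏⇒⋣ : x ⊏ y → ¬ y ⊑ x
⊏⇒⋣ {x} (⊏-in (q , Uq , Lq)) (⊑-in y≤x) = disjoint x (y≤x q Lq , Uq)

⊏-⊑-trans : x ⊏ y → y ⊑ z → x ⊏ z
⊏-⊑-trans (⊏-in (q , Uq , Lq)) (⊑-in y≤z) = ⊏-in (q , Uq , y≤z q Lq)

⊑-⊏-trans : x ⊑ y → y ⊏ z → x ⊏ z
⊑-⊏-trans {x} {y} (⊑-in x≤y) (⊏-in (q , Uq , Lq)) = ⊏-in (q , U-antitone x y x≤y Uq , Lq)

⊏-trans : x ⊏ y → y ⊏ z → x ⊏ z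
⊏-trans p q = ⊏-⊑-trans p (⊏⇒⊑ q)

-- Constructive: a lower bound `q` of `y` can be enlarged to `r`, and locating `x` between them
-- leaves only `L x q`, as `Up x r` would witness `x ⊏ y`.
⊏̸⇒⊒ : ¬ x ⊏ y → y ⊑ x
⊏̸⇒⊒ {x} {y} x≮y = ⊑-in λ q Lq →
  let r , q<r , Lr = L-open y Lq
  in [ id , (λ Ur → ⊥-elim (x≮y (⊏-in (r , Ur , Lr)))) ]′ (located x q<r)

-- Cuts are open, so the rational witnessing the inequality already lies strictly between. All
-- intermediate thresholds and test points below come from here.
⊏-dense : x ⊏ y → ∃[ q ] x ⊏ fromℚ q × fromℚ q ⊏ y
⊏-dense {x} {y} (⊏-in (q , Uq , Lq)) =
  let r , r<q , Ur = U-open x Uq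
      s , q<s , Ls = L-open y Lq
  in q , ⊏-in (r , Ur , r<q) , ⊏-in (s , q<s , Ls)

fromℚ-mono-< : ∀ q r → q <ℚ r → fromℚ q ⊏ fromℚ r
fromℚ-mono-< _ _ q<r = ⊏-in (ℚ.<-dense q<r)

fromℚ-cancel-< : ∀ q r → x ≡ fromℚ q → y ≡ fromℚ r → x ⊏ y → q <ℚ r
fromℚ-cancel-< _ _ refl refl (⊏-in (_ , q<s , s<r)) = ℚ.<-trans q<s s<r

-- Opaque, as 1-_ unfolds to a record of cuts.
opaque
  ⊖_ : ℝ → ℝ
  ⊖ x = 1- x

  𝕀-neg-⊖ : ∀ x → val (𝕀-neg x) ≡ ⊖ val x
  𝕀-neg-⊖ x = refl

  ⊖-antitone : x ⊑ y → ⊖ y ⊑ ⊖ x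
  ⊖-antitone {x} {y} (⊑-in x≤y) = ⊑-in λ _ → U-antitone x y x≤y

  ⊖-strict : x ⊏ y → ⊖ y ⊏ ⊖ x
  ⊖-strict {x} {y} (⊏-in (q , Uq , Lq)) =
    ⊏-in (1ℚ - q , subst (L y) (sym (1-invol q)) Lq , subst (Up x) (sym (1-invol q)) Uq)

  ⊖-involutive : ⊖ (⊖ x) ≈ x
  ⊖-involutive {x} =
      ⊑-in (λ q → subst (L x) (1-invol q))
    , ⊑-in (λ q → subst (L x) (sym (1-invol q)))

  ⊖-fromℚ : ∀ {q r} → x ≡ fromℚ q → y ≡ fromℚ r → 1ℚ - q ≡ r → ⊖ x ≈ y
  ⊖-fromℚ {q = q} refl refl refl =
      ⊑-in (λ r p → subst (_<ℚ 1ℚ - q) (1-invol r) (1-anti p))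
    , ⊑-in (λ r p → subst (_<ℚ 1ℚ - r) (1-invol q) (1-anti p))

⊖-cong : x ≈ y → ⊖ x ≈ ⊖ y
⊖-cong (p , q) = ⊖-antitone q , ⊖-antitone p

⊖-cancel : ⊖ x ⊑ ⊖ y → y ⊑ x
⊖-cancel p = ⊑-trans (proj₂ ⊖-involutive) (⊑-trans (⊖-antitone p) (proj₁ ⊖-involutive))

⊖½≈½ : ⊖ ½ℝ ≈ ½ℝ
⊖½≈½ = ⊖-fromℚ {½ℝ} {½ℝ} {½} {½} refl refl refl

⊖1≈0 : ⊖ 1ℝ ≈ 0ℝ
⊖1≈0 = ⊖-fromℚ {1ℝ} {0ℝ} {1ℚ} {0ℚ} refl refl refl

⊖0≈1 : ⊖ 0ℝ ≈ 1ℝ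
⊖0≈1 = ⊖-fromℚ {0ℝ} {1ℝ} {0ℚ} {1ℚ} refl refl refl

0⊏½ : 0ℝ ⊏ ½ℝ
0⊏½ = fromℚ-mono-< 0ℚ ½ (ℚ.positive⁻¹ ½)

½<1 : ½ <ℚ 1ℚ
½<1 = from-yes (½ ℚ.<? 1ℚ)

½⊏1 : ½ℝ ⊏ 1ℝ
½⊏1 = fromℚ-mono-< ½ 1ℚ ½<1

½⊏⊖ : x ⊏ ½ℝ → ½ℝ ⊏ ⊖ x
½⊏⊖ x⊏½ = ⊑-⊏-trans (proj₂ ⊖½≈½) (⊖-strict x⊏½)

⊖⊏½ : ½ℝ ⊏ x → ⊖ x ⊏ ½ℝ
⊖⊏½ ½⊏x = ⊏-⊑-trans (⊖-strict ½⊏x) (proj₁ ⊖½≈½)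

⊖⊏1 : 0ℝ ⊏ x → ⊖ x ⊏ 1ℝ
⊖⊏1 0⊏x = ⊏-⊑-trans (⊖-strict 0⊏x) (proj₁ ⊖0≈1)

0⊏1 : 0ℝ ⊏ 1ℝ
0⊏1 = ⊏-trans 0⊏½ ½⊏1

-- Affine maps of the rationals act on the reals

-- The inverse is part of the data: a cut is moved by precomposing with `from`, while `to` supplies
-- the rationals required for inhabitedness and openness.
record Automorphism : Set where
  field
    to from   : ℚ → ℚ
    to-mono   : ∀ {q r} → q <ℚ r → to q <ℚ to r
    from-mono : ∀ {q r} → q <ℚ r → from q <ℚ from r
    to∘from   : ∀ q → to (from q) ≡ q
    from∘to   : ∀ q → from (to q) ≡ q

module _ {c d} (c<d : c <ℚ d) where

  width-positive : Positive (d - c)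
  width-positive = positive (subst (_<ℚ d - c) (ℚ.+-inverseʳ c) (ℚ.+-monoˡ-< (- c) c<d))

  1/width : ℚ
  1/width = (1/ (d - c)) {{ℚ.pos⇒nonZero (d - c) {{width-positive}}}}

  1/width-inverse : 1/width * (d - c) ≡ 1ℚ
  1/width-inverse = ℚ.*-inverseˡ (d - c) {{ℚ.pos⇒nonZero (d - c) {{width-positive}}}}

  1/width-positive : Positive 1/width
  1/width-positive = ℚ.1/pos⇒pos (d - c) {{width-positive}}

module _ {c d c′ d′} (c<d : c <ℚ d) (c′<d′ : c′ <ℚ d′) where

  interpolate : ℚ → ℚ
  interpolate q = c′ + (d′ - c′) * (1/width c<d * (q - c))

  interpolate-mono : ∀ {q r} → q <ℚ r → interpolate q <ℚ interpolate r
  interpolate-mono q<r =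
    ℚ.+-monoʳ-< c′
      (ℚ.*-monoʳ-<-pos (d′ - c′) {{width-positive c′<d′}}
        (ℚ.*-monoʳ-<-pos (1/width c<d) {{1/width-positive c<d}}
          (ℚ.+-monoˡ-< (- c) q<r)))

  interpolate-left : interpolate c ≡ c′
  interpolate-left = solve 4 (λ c c′ e r → c′ :+ e :* (r :* (c :- c)) := c′) refl
    c c′ (d′ - c′) (1/width c<d)
    where open +-*-Solver

  interpolate-right : interpolate d ≡ d′
  interpolate-right = begin
    c′ + (d′ - c′) * (1/width c<d * (d - c)) ≡⟨ cong (λ t → c′ + (d′ - c′) * t) (1/width-inverse c<d) ⟩
    c′ + (d′ - c′) * 1ℚ                      ≡⟨ cong (c′ +_) (ℚ.*-identityʳ (d′ - c′)) ⟩
    c′ + (d′ - c′)                           ≡⟨ solve 2 (λ c d → c :+ (d :- c) := d) refl c′ d′ ⟩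
    d′                                       ∎
    where
    open ≡-Reasoning
    open +-*-Solver

interpolate-inverse : ∀ {c d c′ d′} (c<d : c <ℚ d) (c′<d′ : c′ <ℚ d′) q →
  interpolate c′<d′ c<d (interpolate c<d c′<d′ q) ≡ q
interpolate-inverse {c} {d} {c′} {d′} c<d c′<d′ q = begin
  c + e * (r′ * (c′ + e′ * (r * (q - c)) - c′))
    -- The solver treats the reciprocals as independent variables, so it only brings each width next
    -- to its own reciprocal; the cancellation is a separate step.
    ≡⟨ solve 7 (λ c e r c′ e′ r′ q →
         c :+ e :* (r′ :* (c′ :+ e′ :* (r :* (q :- c)) :- c′))
         := c :+ (r :* e) :* ((r′ :* e′) :* (q :- c))) refl c e r c′ e′ r′ q ⟩
  c + (r * e) * ((r′ * e′) * (q - c))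
    ≡⟨ cong₂ (λ s t → c + s * (t * (q - c))) (1/width-inverse c<d) (1/width-inverse c′<d′) ⟩
  c + 1ℚ * (1ℚ * (q - c))
    ≡⟨ solve 2 (λ c q → c :+ con 1ℚ :* (con 1ℚ :* (q :- c)) := q) refl c q ⟩
  q ∎
  where
  open ≡-Reasoning
  open +-*-Solver
  e = d - c
  e′ = d′ - c′
  r = 1/width c<d
  r′ = 1/width c′<d′

affine : ∀ {c d c′ d′} → c <ℚ d → c′ <ℚ d′ → Automorphism
affine c<d c′<d′ = record
  { to        = interpolate c<d c′<d′
  ; from      = interpolate c′<d′ c<d
  ; to-mono   = interpolate-mono c<d c′<d′
  ; from-mono = interpolate-mono c′<d′ c<d
  ; to∘from   = interpolate-inverse c′<d′ c<d
  ; from∘to   = interpolate-inverse c<d c′<d′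
  }

module Action (α : Automorphism) where
  open Automorphism α

  opaque
    act : ℝ → ℝ
    act x = record
      { L           = L x ∘ from
      ; U           = Up x ∘ from
      ; L-inhabited = let q , Lq = L-inhabited x in to q , subst (L x) (sym (from∘to q)) Lq
      ; U-inhabited = let q , Uq = U-inhabited x in to q , subst (Up x) (sym (from∘to q)) Uq
      ; L-down      = L-down x ∘ from-mono
      ; L-open      = λ {q} Lq → let r , q<r , Lr = L-open x Lq in
          to r , subst (_<ℚ to r) (to∘from q) (to-mono q<r) , subst (L x) (sym (from∘to r)) Lr
      ; U-up        = U-up x ∘ from-mono
      ; U-open      = λ {q} Uq → let r , r<q , Ur = U-open x Uq in
          to r , subst (to r <ℚ_) (to∘from q) (to-mono r<q) , subst (Up x) (sym (from∘to r)) Ur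
      ; disjoint    = disjoint x
      ; located     = located x ∘ from-mono
      }

    act-mono : x ⊑ y → act x ⊑ act y
    act-mono (⊑-in x≤y) = ⊑-in λ _ → x≤y _

    act-cancel : act x ⊑ act y → x ⊑ y
    act-cancel {x} {y} (⊑-in p) = ⊑-in λ q Lq →
      subst (L y) (from∘to q) (p (to q) (subst (L x) (sym (from∘to q)) Lq))

    act-fromℚ : ∀ {q r} → to q ≡ r → act (fromℚ q) ≈ fromℚ r
    act-fromℚ {q} refl =
        ⊑-in (λ s p → subst (_<ℚ to q) (to∘from s) (to-mono p))
      , ⊑-in (λ s p → subst (from s <ℚ_) (from∘to q) (from-mono p))

-- Order embeddings from rational rescalings.

Reflecting : (ℝ → ℝ) → ℝ → ℝ → Set
Reflecting f x y = (x ⊑ y → f x ⊑ f y) × (f x ⊑ f y → x ⊑ y)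

-- Relative to a domain, because embeddings are glued from pieces; one of these is a constant map,
-- which embeds nothing larger than a point.
EmbeddingOn : Pred ℝ 0ℓ → (ℝ → ℝ) → Set₁
EmbeddingOn D f = ∀ {x y} → x ∈ D → y ∈ D → Reflecting f x y

rescale : ∀ {x y x′ y′} c d c′ d′ → x ≡ fromℚ c → y ≡ fromℚ d → x′ ≡ fromℚ c′ → y′ ≡ fromℚ d′ →
  c <ℚ d → c′ <ℚ d′ → ∃[ f ] EmbeddingOn U f × f x ≈ x′ × f y ≈ y′
rescale _ _ _ _ refl refl refl refl c<d c′<d′ =
    act , (λ _ _ → act-mono , act-cancel)
  , act-fromℚ (interpolate-left c<d c′<d′) , act-fromℚ (interpolate-right c<d c′<d′)
  where open Action (affine c<d c′<d′)

-- Sending 1 to a rational strictly below `y`, rather than to `y`, keeps the coefficients rational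
-- when `y` is irrational. The gap this leaves is harmless, as continuity is not asked for.
contract-low : ½ℝ ⊏ y → ∃[ f ] EmbeddingOn U f × f ½ℝ ≈ ½ℝ × f 1ℝ ⊏ y
contract-low ½⊏y =
  let a , ½⊏a , a⊏y = ⊏-dense ½⊏y
      f , f-emb , f½ , f1 = rescale ½ 1ℚ ½ a refl refl refl refl ½<1
                              (fromℚ-cancel-< ½ a refl refl ½⊏a)
  in f , f-emb , f½ , ⊑-⊏-trans (proj₁ f1) a⊏y

contract-high : y ⊏ 1ℝ → ∃[ f ] EmbeddingOn U f × f 1ℝ ≈ 1ℝ × y ⊏ f ½ℝ
contract-high y⊏1 =
  let b , y⊏b , b⊏1 = ⊏-dense y⊏1
      f , f-emb , f½ , f1 = rescale ½ 1ℚ b 1ℚ refl refl refl refl ½<1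
                              (fromℚ-cancel-< b 1ℚ refl refl b⊏1)
  in f , f-emb , f1 , ⊏-⊑-trans y⊏b (proj₂ f½)

record OddEmbedding : Set₁ where
  field
    fun  : ℝ → ℝ
    mono : x ⊑ y → fun x ⊑ fun y
    cancel : fun x ⊑ fun y → x ⊑ y
    odd  : fun (⊖ x) ≈ ⊖ fun x
    one  : fun 1ℝ ≈ 1ℝ

  congruent : x ≈ y → fun x ≈ fun y
  congruent (p , q) = mono p , mono q

  -- Oddness turns the fixed point 1 into the fixed point 1 - 1. The constant `⊥̇` and the
  -- restriction to `𝕀` rely on it.
  fix0 : fun 0ℝ ≈ 0ℝ
  fix0 = ≈-trans (congruent (≈-sym ⊖1≈0))
    (≈-trans odd (≈-trans (⊖-cong one) ⊖1≈0))

  on𝕀 : 𝕀 → 𝕀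
  on𝕀 x = mk𝕀 (fun (val x))
    (⊑-out (⊑-trans (proj₂ fix0) (mono (⊑-in (0≤val x)))))
    (⊑-out (⊑-trans (mono (⊑-in (val≤1 x))) (proj₁ one)))

module Classical (em : ExcludedMiddle 0ℓ) where
  open StandardAlgebra em

  -- Classical, unlike `⊏̸⇒⊒`: that lemma only refutes `¬ y ⊏ x`, and excluded middle removes the
  -- double negation.
  ⋢⇒⊐ : ¬ x ⊑ y → y ⊏ x
  ⋢⇒⊐ x⋢y = decidable-stable em (x⋢y ∘ ⊏̸⇒⊒)

  -- Order embeddings

  glue : Pred ℝ 0ℓ → (f g : ℝ → ℝ) → ℝ → ℝ
  glue P f g x = if does (em {x ∈ P}) then f x else g x

  module _ (P : Pred ℝ 0ℓ) (f g : ℝ → ℝ) where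

    glue-in : x ∈ P → glue P f g x ≡ f x
    glue-in {x} p = cong (if_then f x else g x) (dec-true em p)

    glue-out : x ∉ P → glue P f g x ≡ g x
    glue-out {x} p = cong (if_then f x else g x) (dec-false em p)

    -- The part of `D` inside `P` lies strictly below the rest, and so do the images; hence every
    -- mixed comparison has the same outcome before and after.
    glue-embedding : ∀ D → EmbeddingOn (D ∩ P) f → EmbeddingOn (D ∩ ∁ P) g →
      (∀ {x y} → x ∈ D ∩ P → y ∈ D ∩ ∁ P → x ⊏ y × f x ⊏ g y) →
      EmbeddingOn D (glue P f g)
    glue-embedding _ ef eg cross {x} {y} Dx Dy with em {x ∈ P} | em {y ∈ P}
    ... | yes Px | yes Py = ef (Dx , Px) (Dy , Py)
    ... | no ¬Px | no ¬Py = eg (Dx , ¬Px) (Dy , ¬Py)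
    ... | yes Px | no ¬Py =
      let x⊏y , fx⊏gy = cross (Dx , Px) (Dy , ¬Py)
      in (λ _ → ⊏⇒⊑ fx⊏gy) , (λ _ → ⊏⇒⊑ x⊏y)
    ... | no ¬Px | yes Py =
      let y⊏x , fy⊏gx = cross (Dy , Py) (Dx , ¬Px)
      in (λ p → ⊥-elim (⊏⇒⋣ y⊏x p)) , (λ p → ⊥-elim (⊏⇒⋣ fy⊏gx p))

  module OddExtension (g : ℝ → ℝ) (eg : EmbeddingOn U g) (g½ : g ½ℝ ≈ ½ℝ) where

    reflected extended : ℝ → ℝ
    reflected x = ⊖ g (⊖ x)
    extended = glue (_⊏ ½ℝ) reflected g

    extended-low : x ⊏ ½ℝ → extended x ≡ reflected x
    extended-low = glue-in (_⊏ ½ℝ) reflected g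

    extended-high : ¬ x ⊏ ½ℝ → extended x ≡ g x
    extended-high = glue-out (_⊏ ½ℝ) reflected g

    g-mono : x ⊑ y → g x ⊑ g y
    g-mono = proj₁ (eg _ _)

    g-cong : x ≈ y → g x ≈ g y
    g-cong (p , q) = g-mono p , g-mono q

    ½⊏g : ½ℝ ⊏ x → ½ℝ ⊏ g x
    ½⊏g ½⊏x = ⋢⇒⊐ λ gx⊑½ → ⊏⇒⋣ ½⊏x (proj₂ (eg _ _) (⊑-trans gx⊑½ (proj₂ g½)))

    reflected⊏½ : x ⊏ ½ℝ → reflected x ⊏ ½ℝ
    reflected⊏½ x⊏½ = ⊖⊏½ (½⊏g (½⊏⊖ x⊏½))

    extended-embedding : EmbeddingOn U extended
    extended-embedding = glue-embedding (_⊏ ½ℝ) reflected g U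
      (λ _ _ → ⊖-antitone ∘ g-mono ∘ ⊖-antitone
             , ⊖-cancel ∘ proj₂ (eg _ _) ∘ ⊖-cancel)
      (λ _ _ → eg _ _)
      (λ (_ , x⊏½) (_ , ¬y⊏½) →
          ⊏-⊑-trans x⊏½ (⊏̸⇒⊒ ¬y⊏½)
        , ⊏-⊑-trans (reflected⊏½ x⊏½) (⊑-trans (proj₂ g½) (g-mono (⊏̸⇒⊒ ¬y⊏½))))

    -- If exactly one of `x` and `⊖ x` is below ½, both sides agree up to a double reflection. Both
    -- below is absurd, and neither below forces `x ≈ ½ℝ`, where `g½` decides.
    extended-odd : ∀ x → Dec (x ⊏ ½ℝ) → Dec (⊖ x ⊏ ½ℝ) → extended (⊖ x) ≈ ⊖ extended x
    extended-odd x (yes x⊏½) (yes 1-x⊏½) = ⊥-elim (⊏⇒⋣ (½⊏⊖ x⊏½) (⊏⇒⊑ 1-x⊏½))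
    extended-odd x (yes x⊏½) (no ¬1-x⊏½) = subst₂ (λ s t → s ≈ ⊖ t)
      (sym (extended-high ¬1-x⊏½)) (sym (extended-low x⊏½)) (≈-sym ⊖-involutive)
    extended-odd x (no ¬x⊏½) (yes 1-x⊏½) = subst₂ (λ s t → s ≈ ⊖ t)
      (sym (extended-low 1-x⊏½)) (sym (extended-high ¬x⊏½)) (⊖-cong (g-cong ⊖-involutive))
    extended-odd x (no ¬x⊏½) (no ¬1-x⊏½) = subst₂ (λ s t → s ≈ ⊖ t)
      (sym (extended-high ¬1-x⊏½)) (sym (extended-high ¬x⊏½))
      (≈-trans g[1-x]≈½ (≈-trans (≈-sym ⊖½≈½) (⊖-cong (≈-sym gx≈½))))
      where
      x≈½ : x ≈ ½ℝ
      x≈½ = ⊑-trans (proj₂ ⊖-involutive) (⊑-trans (⊖-antitone (⊏̸⇒⊒ ¬1-x⊏½)) (proj₁ ⊖½≈½))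
          , ⊏̸⇒⊒ ¬x⊏½
      gx≈½ : g x ≈ ½ℝ
      gx≈½ = ≈-trans (g-cong x≈½) g½
      g[1-x]≈½ : g (⊖ x) ≈ ½ℝ
      g[1-x]≈½ = ≈-trans (g-cong (≈-trans (⊖-cong x≈½) ⊖½≈½)) g½

    oddExtension : g 1ℝ ≈ 1ℝ → OddEmbedding
    oddExtension g1 = record
      { fun   = extended
      ; mono  = proj₁ (extended-embedding _ _)
      ; cancel = proj₂ (extended-embedding _ _)
      ; odd   = extended-odd _ em em
      ; one   = subst (_≈ 1ℝ) (sym (extended-high (λ 1⊏½ → ⊏⇒⋣ 1⊏½ (⊏⇒⊑ ½⊏1)))) g1
      }

  -- Reals below `p` are below 1 and so land at most at `lo 1ℝ`; reals above `p` are above ½ and so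
  -- land at least at `hi ½ℝ`. The value `p′` sits strictly between these bounds and is free for `p`
  -- itself.
  module Stretch {p p′ : ℝ} (½⊏p : ½ℝ ⊏ p) (p⊏1 : p ⊏ 1ℝ)
    {lo : ℝ → ℝ} (lo-emb : EmbeddingOn U lo) (lo½ : lo ½ℝ ≈ ½ℝ) (lo1⊏p′ : lo 1ℝ ⊏ p′)
    {hi : ℝ → ℝ} (hi-emb : EmbeddingOn U hi) (hi1 : hi 1ℝ ≈ 1ℝ) (p′⊏hi½ : p′ ⊏ hi ½ℝ) where

    upper stretch : ℝ → ℝ
    -- Within `stretch` this acts only outside `_⊏ p`, so its constant piece serves just the reals
    -- equal to `p`.
    upper = glue (_⊑ p) (const p′) hi
    stretch = glue (_⊏ p) lo upper

    p′⊏hi : ¬ y ⊑ p → p′ ⊏ hi y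
    p′⊏hi ¬y⊑p = ⊏-⊑-trans p′⊏hi½ (proj₁ (hi-emb _ _) (⊏⇒⊑ (⊏-trans ½⊏p (⋢⇒⊐ ¬y⊑p))))

    p′⊑upper : p′ ⊑ upper y
    p′⊑upper {y} with em {y ⊑ p}
    ... | yes _    = ⊑-refl
    ... | no ¬y⊑p  = ⊏⇒⊑ (p′⊏hi ¬y⊑p)

    upper-embedding : EmbeddingOn (U ∩ ∁ (_⊏ p)) upper
    upper-embedding = glue-embedding (_⊑ p) (const p′) hi (U ∩ ∁ (_⊏ p))
      (λ (_ , x⊑p) ((_ , ¬y⊏p) , _) → (λ _ → ⊑-refl) , (λ _ → ⊑-trans x⊑p (⊏̸⇒⊒ ¬y⊏p)))
      (λ _ _ → hi-emb _ _)
      (λ (_ , x⊑p) (_ , ¬y⊑p) → ⊑-⊏-trans x⊑p (⋢⇒⊐ ¬y⊑p) , p′⊏hi ¬y⊑p)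

    stretch-embedding : EmbeddingOn U stretch
    stretch-embedding = glue-embedding (_⊏ p) lo upper U (λ _ _ → lo-emb _ _) upper-embedding
      (λ (_ , x⊏p) (_ , ¬y⊏p) →
          ⊏-⊑-trans x⊏p (⊏̸⇒⊒ ¬y⊏p)
        , ⊏-⊑-trans (⊑-⊏-trans (proj₁ (lo-emb _ _) (⊏⇒⊑ (⊏-trans x⊏p p⊏1))) lo1⊏p′) p′⊑upper)

    stretch-½ : stretch ½ℝ ≈ ½ℝ
    stretch-½ = subst (_≈ ½ℝ) (sym (glue-in (_⊏ p) lo upper ½⊏p)) lo½

    stretch-p : stretch p ≡ p′
    stretch-p = trans
      (glue-out (_⊏ p) lo upper (λ p⊏p → ⊏⇒⋣ p⊏p ⊑-refl))
      (glue-in (_⊑ p) (const p′) hi ⊑-refl)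

    stretch-1 : stretch 1ℝ ≈ 1ℝ
    stretch-1 = subst (_≈ 1ℝ)
      (sym (trans (glue-out (_⊏ p) lo upper (λ 1⊏p → ⊏⇒⋣ 1⊏p (⊏⇒⊑ p⊏1)))
                  (glue-out (_⊑ p) (const p′) hi (⊏⇒⋣ p⊏1))))
      hi1

    open OddExtension stretch stretch-embedding stretch-½

    moving : Σ OddEmbedding λ f → OddEmbedding.fun f p ≈ p′
    moving = oddExtension stretch-1
      , subst (_≈ p′) (sym (trans (extended-high (λ p⊏½ → ⊏⇒⋣ ½⊏p (⊏⇒⊑ p⊏½))) stretch-p)) ≈-refl

  moving⁺ : ∀ {p p′} → ½ℝ ⊏ p → p ⊏ 1ℝ → ½ℝ ⊏ p′ → p′ ⊏ 1ℝ →
    Σ OddEmbedding λ f → OddEmbedding.fun f p ≈ p′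
  moving⁺ ½⊏p p⊏1 ½⊏p′ p′⊏1 =
    let lo , lo-emb , lo½ , lo1⊏p′ = contract-low ½⊏p′
        hi , hi-emb , hi1 , p′⊏hi½ = contract-high p′⊏1
    in Stretch.moving ½⊏p p⊏1 {lo} lo-emb lo½ lo1⊏p′ {hi} hi-emb hi1 p′⊏hi½

  -- An odd map sending 1 - n to 1 - n′ sends n to n′, and the reflected thresholds lie in (½,1).
  moving⁻ : ∀ {n n′} → 0ℝ ⊏ n → n ⊏ ½ℝ → 0ℝ ⊏ n′ → n′ ⊏ ½ℝ →
    Σ OddEmbedding λ f → OddEmbedding.fun f n ≈ n′
  moving⁻ 0⊏n n⊏½ 0⊏n′ n′⊏½ =
    let f , f[1-n]≈1-n′ = moving⁺ (½⊏⊖ n⊏½) (⊖⊏1 0⊏n) (½⊏⊖ n′⊏½) (⊖⊏1 0⊏n′)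
        open OddEmbedding f
    in f , ≈-trans (congruent (≈-sym ⊖-involutive))
             (≈-trans odd (≈-trans (⊖-cong f[1-n]≈1-n′) ⊖-involutive))

  -- Invariance of the logics under embeddings, and approximation of thresholds

  ⊓-left : ∀ x y → val x ⊑ val y → x ⊓ y ≡ x
  ⊓-left x y p = cong (if_then x else y) (dec-true em (⊑-out p))

  ⊓-right : ∀ x y → ¬ val x ⊑ val y → x ⊓ y ≡ y
  ⊓-right x y p = cong (if_then x else y) (dec-false em (p ∘ ⊑-in))

  ⇒-one : ∀ x y → val x ⊑ val y → x ⇒ y ≡ 𝕀-one
  ⇒-one x y p = cong (if_then 𝕀-one else y) (dec-true em (⊑-out p))

  ⇒-right : ∀ x y → ¬ val x ⊑ val y → x ⇒ y ≡ y
  ⇒-right x y p = cong (if_then 𝕀-one else y) (dec-false em (p ∘ ⊑-in))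

  module _ (f : OddEmbedding) where
    open OddEmbedding f

    mono-image : ∀ {x x′ y y′} → val x′ ≈ fun (val x) → val y′ ≈ fun (val y) →
      val x ⊑ val y → val x′ ⊑ val y′
    mono-image ex ey p = ⊑-trans (proj₁ ex) (⊑-trans (mono p) (proj₂ ey))

    cancel-image : ∀ {x x′ y y′} → val x′ ≈ fun (val x) → val y′ ≈ fun (val y) →
      val x′ ⊑ val y′ → val x ⊑ val y
    cancel-image ex ey p = cancel (⊑-trans (proj₂ ex) (⊑-trans p (proj₁ ey)))

    Image : 𝕀 → 𝕀 → Set
    Image x x′ = val x′ ≈ fun (val x)

    -- The operation branches on a comparison that the embedding preserves and reflects, so both
    -- sides take the same branch.
    ⊓-image : ∀ x x′ y y′ → Dec (val x ⊑ val y) → Image x x′ → Image y y′ →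
      Image (x ⊓ y) (x′ ⊓ y′)
    ⊓-image x x′ y y′ (yes p) ex ey = subst₂ Image
      (sym (⊓-left x y p)) (sym (⊓-left x′ y′ (mono-image {x} {x′} {y} {y′} ex ey p))) ex
    ⊓-image x x′ y y′ (no ¬p) ex ey = subst₂ Image
      (sym (⊓-right x y ¬p)) (sym (⊓-right x′ y′ (¬p ∘ cancel-image {x} {x′} {y} {y′} ex ey))) ey

    ⇒-image : ∀ x x′ y y′ → Dec (val x ⊑ val y) → Image x x′ → Image y y′ →
      Image (x ⇒ y) (x′ ⇒ y′)
    ⇒-image x x′ y y′ (yes p) ex ey = subst₂ Image
      (sym (⇒-one x y p)) (sym (⇒-one x′ y′ (mono-image {x} {x′} {y} {y′} ex ey p))) (≈-sym one)
    ⇒-image x x′ y y′ (no ¬p) ex ey = subst₂ Image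
      (sym (⇒-right x y ¬p)) (sym (⇒-right x′ y′ (¬p ∘ cancel-image {x} {x′} {y} {y′} ex ey))) ey

    neg-image : ∀ x x′ → Image x x′ → Image (𝕀-neg x) (𝕀-neg x′)
    neg-image x x′ ex = subst₂ (λ s t → t ≈ fun s)
      (sym (𝕀-neg-⊖ x)) (sym (𝕀-neg-⊖ x′)) (≈-trans (⊖-cong ex) (≈-sym odd))

    ⟦⟧-image : ∀ φ v → Image (⟦ φ ⟧ v) (⟦ φ ⟧ (on𝕀 ∘ v))
    ⟦⟧-image (var i)  v = ≈-refl
    ⟦⟧-image ⊥̇        v = ≈-sym fix0
    ⟦⟧-image (φ ∧̇ ψ)  v = ⊓-image (⟦ φ ⟧ v) (⟦ φ ⟧ (on𝕀 ∘ v)) (⟦ ψ ⟧ v) (⟦ ψ ⟧ (on𝕀 ∘ v)) em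
                             (⟦⟧-image φ v) (⟦⟧-image ψ v)
    ⟦⟧-image (φ →̇ ψ)  v = ⇒-image (⟦ φ ⟧ v) (⟦ φ ⟧ (on𝕀 ∘ v)) (⟦ ψ ⟧ v) (⟦ ψ ⟧ (on𝕀 ∘ v)) em
                             (⟦⟧-image φ v) (⟦⟧-image ψ v)
    ⟦⟧-image (∼̇ φ)    v = neg-image (⟦ φ ⟧ v) (⟦ φ ⟧ (on𝕀 ∘ v)) (⟦⟧-image φ v)

    -- Contravariant: composing a countermodel for `F` with the embedding gives one for `F′`. Since
    -- the embedding need not be onto, the converse inclusion requires another embedding, moving the
    -- threshold back.
    transfer : ∀ (F F′ : Pred 𝕀 0ℓ) →
      (∀ x x′ → Image x x′ → F x → F′ x′) → (∀ x x′ → Image x x′ → F′ x′ → F x) →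
      logicOf F′ ⊆′ logicOf F
    transfer F F′ to from (Γ , φ) s v Γ∈F = from _ _ (⟦⟧-image φ v)
      (s (on𝕀 ∘ v) λ {γ} γ∈Γ → to _ _ (⟦⟧-image γ v) (Γ∈F γ∈Γ))

    module _ {a a′} (fa : fun a ≈ a′) where

      [-transfer : (⊢[ a′) ⊆′ (⊢[ a)
      [-transfer = transfer [ a ,1] [ a′ ,1]
        (λ x x′ ex a≤x → ⊑-out (⊑-trans (proj₂ fa) (⊑-trans (mono (⊑-in a≤x)) (proj₂ ex))))
        (λ x x′ ex a′≤x′ → ⊑-out (cancel (⊑-trans (proj₁ fa) (⊑-trans (⊑-in a′≤x′) (proj₁ ex)))))

      ⦅-transfer : (⊢⦅ a′) ⊆′ (⊢⦅ a)
      ⦅-transfer = transfer ⦅ a ,1] ⦅ a′ ,1]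
        (λ x x′ ex a<x → ⊏-out (⋢⇒⊐ λ x′⊑a′ → ⊏⇒⋣ (⊏-in a<x)
          (cancel (⊑-trans (proj₂ ex) (⊑-trans x′⊑a′ (proj₂ fa))))))
        (λ x x′ ex a′<x′ → ⊏-out (⋢⇒⊐ λ x⊑a → ⊏⇒⋣ (⊏-in a′<x′)
          (⊑-trans (proj₁ ex) (⊑-trans (mono x⊑a) (proj₁ fa)))))

  -- Filters squeezed between (a,1] and [a,1], so that closed and open thresholds are approximated
  -- by one argument.
  Between : (ℝ → Pred 𝕀 0ℓ) → Set₁
  Between F = ∀ a x → (a ⊏ val x → F a x) × (F a x → a ⊑ val x)

  between-[ : Between [_,1]
  between-[ a x = (⊑-out ∘ ⊏⇒⊑) , ⊑-in

  between-⦅ : Between ⦅_,1]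
  between-⦅ a x = ⊏-out , ⊏⇒⊑ ∘ ⊏-in

  above-both : x ⊏ z → y ⊏ z → ∃[ a ] x ⊏ a × y ⊏ a × a ⊏ z
  above-both {x} {z} {y} x⊏z y⊏z = case em {x ⊑ y} of λ where
    (yes x⊑y) → let q , y⊏q , q⊏z = ⊏-dense y⊏z in fromℚ q , ⊑-⊏-trans x⊑y y⊏q , y⊏q , q⊏z
    (no ¬x⊑y) → let q , x⊏q , q⊏z = ⊏-dense x⊏z
                in fromℚ q , x⊏q , ⊏-trans (⋢⇒⊐ ¬x⊑y) x⊏q , q⊏z

  -- In a countermodel at `b` the conclusion is strictly below `b`, which bounds all premises at
  -- once, even infinitely many. A threshold inside this gap, and above `c`, refutes the same
  -- sequent.
  approx-below : ∀ F → Between F → ∀ {c b} → c ⊏ b → ∀ s →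
    (∀ a → c ⊏ a → a ⊏ b → s ∈ logicOf (F a)) → s ∈ ⊢[ b
  approx-below F between c⊏b (Γ , φ) ⊢a v Γ≥b = ⊑-out (⊏̸⇒⊒ {val (⟦ φ ⟧ v)} λ φ⊏b →
    let a , c⊏a , φ⊏a , a⊏b = above-both c⊏b φ⊏b
    in ⊏⇒⋣ φ⊏a (proj₂ (between a (⟦ φ ⟧ v)) (⊢a a c⊏a a⊏b v λ {γ} γ∈Γ →
         proj₁ (between a (⟦ γ ⟧ v)) (⊏-⊑-trans a⊏b (⊑-in (Γ≥b γ∈Γ))))))

  -- Each premise may lower the threshold once. This is where finiteness enters: infinitely many
  -- values above `b` can have infimum `b`.
  below-all : ∀ {b d v} Γ₀ → b ⊏ d → All (λ γ → b ⊏ val (⟦ γ ⟧ v)) Γ₀ →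
    ∃[ a ] b ⊏ a × a ⊏ d × All (λ γ → a ⊑ val (⟦ γ ⟧ v)) Γ₀
  below-all [] b⊏d [] = let q , b⊏q , q⊏d = ⊏-dense b⊏d in fromℚ q , b⊏q , q⊏d , []
  below-all {b} {d} {v} (γ ∷ Γ₀) b⊏d (b⊏γ ∷ b⊏Γ₀) =
    let a , b⊏a , a⊏d , a⊑Γ₀ = below-all {v = v} Γ₀ b⊏d b⊏Γ₀
    in case em {a ⊑ val (⟦ γ ⟧ v)} of λ where
      (yes a⊑γ) → a , b⊏a , a⊏d , a⊑γ ∷ a⊑Γ₀
      (no ¬a⊑γ) →
        let q , b⊏q , q⊏γ = ⊏-dense b⊏γ
            q⊏a = ⊏-trans q⊏γ (⋢⇒⊐ ¬a⊑γ)
        in fromℚ q , b⊏q , ⊏-trans q⊏a a⊏d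
         , ⊏⇒⊑ q⊏γ ∷ All.map (⊑-trans (⊏⇒⊑ q⊏a)) a⊑Γ₀

  approx-above : ∀ {b d} → b ⊏ d → ∀ Γ₀ φ →
    (∀ a → b ⊏ a → a ⊏ d → ((_∈ˡ Γ₀) , φ) ∈ ⊢[ a) → ((_∈ˡ Γ₀) , φ) ∈ ⊢⦅ b
  approx-above b⊏d Γ₀ φ ⊢a v Γ₀>b =
    let a , b⊏a , a⊏d , a⊑Γ₀ = below-all {v = v} Γ₀ b⊏d (All.tabulate (⊏-in ∘ Γ₀>b))
        a≤φ = ⊢a a b⊏a a⊏d v λ γ∈Γ₀ → ⊑-out (All.lookup a⊑Γ₀ γ∈Γ₀)
    in ⊏-out (⊏-⊑-trans b⊏a (⊑-in {y = val (⟦ φ ⟧ v)} a≤φ))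

  -- Besides inclusions, this carries refutations of sequents from a logic to its finitary
  -- companion.
  ᶠ⊆ : ∀ F → (logicOf F) ᶠ ⊆′ logicOf F
  ᶠ⊆ F (Γ , φ) (Γ₀ , Γ₀⊆Γ , s) v Γ∈F = s v λ γ∈Γ₀ → Γ∈F (All.lookup Γ₀⊆Γ γ∈Γ₀)

  -- Intervals of interchangeable thresholds, and their endpoints.

  module Homogeneous {c d : ℝ} (c⊏d : c ⊏ d)
    (moving : ∀ {a a′} → c ⊏ a → a ⊏ d → c ⊏ a′ → a′ ⊏ d →
      Σ OddEmbedding λ f → OddEmbedding.fun f a ≈ a′) where

    module _ {a} (c⊏a : c ⊏ a) (a⊏d : a ⊏ d) where

      [-to : ∀ {a′} → c ⊏ a′ → a′ ⊏ d → (⊢[ a) ⊆′ (⊢[ a′)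
      -- By contravariance of `transfer`, the embedding must move `a′` to `a`.
      [-to c⊏a′ a′⊏d = let f , fa = moving c⊏a′ a′⊏d c⊏a a⊏d in [-transfer f fa

      ⦅-to : ∀ {a′} → c ⊏ a′ → a′ ⊏ d → (⊢⦅ a) ⊆′ (⊢⦅ a′)
      ⦅-to c⊏a′ a′⊏d = let f , fa = moving c⊏a′ a′⊏d c⊏a a⊏d in ⦅-transfer f fa

      -- The closed threshold `a` is approximated by open thresholds below it, all of which define
      -- the logic of `⊢⦅ a`.
      ⦅⊆[ : (⊢⦅ a) ⊆′ (⊢[ a)
      ⦅⊆[ s ⊢s = approx-below ⦅_,1] between-⦅ c⊏a s λ a′ c⊏a′ a′⊏a →
        ⦅-to c⊏a′ (⊏-trans a′⊏a a⊏d) s ⊢s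

      [⊆[sup : (⊢[ a) ⊆′ (⊢[ d)
      [⊆[sup s ⊢s = approx-below [_,1] between-[ c⊏d s λ a′ c⊏a′ a′⊏d → [-to c⊏a′ a′⊏d s ⊢s

      [ᶠ⊆⦅ᶠ : (⊢[ a) ᶠ ⊆′ (⊢⦅ a) ᶠ
      [ᶠ⊆⦅ᶠ (Γ , φ) (Γ₀ , Γ₀⊆Γ , ⊢s) = Γ₀ , Γ₀⊆Γ , approx-above a⊏d Γ₀ φ λ a′ a⊏a′ a′⊏d →
        [-to (⊏-trans c⊏a a⊏a′) a′⊏d (_ , φ) ⊢s

      ⦅ᶠ⊆[ᶠ : (⊢⦅ a) ᶠ ⊆′ (⊢[ a) ᶠ
      ⦅ᶠ⊆[ᶠ (Γ , φ) (Γ₀ , Γ₀⊆Γ , ⊢s) = Γ₀ , Γ₀⊆Γ , ⦅⊆[ (_ , φ) ⊢s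

      -- Approximating from above works at the excluded left endpoint too: ½ for the upper interval
      -- and 0 for the lower one.
      [ᶠ⊆⦅inf : (⊢[ a) ᶠ ⊆′ (⊢⦅ c)
      [ᶠ⊆⦅inf (Γ , φ) (Γ₀ , Γ₀⊆Γ , ⊢s) = ᶠ⊆ ⦅ c ,1] (Γ , φ) (Γ₀ , Γ₀⊆Γ ,
        approx-above c⊏d Γ₀ φ λ a′ c⊏a′ a′⊏d → [-to c⊏a′ a′⊏d (_ , φ) ⊢s)

    thresholds-irrelevant : ∀ {a a′} → c ⊏ a → a ⊏ d → c ⊏ a′ → a′ ⊏ d →
      (⊢[ a) ≐ (⊢[ a′) × (⊢⦅ a) ≐ (⊢⦅ a′)
    thresholds-irrelevant c⊏a a⊏d c⊏a′ a′⊏d =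
        ((λ {s} → [-to c⊏a a⊏d c⊏a′ a′⊏d s) , λ {s} → [-to c⊏a′ a′⊏d c⊏a a⊏d s)
      , ((λ {s} → ⦅-to c⊏a a⊏d c⊏a′ a′⊏d s) , λ {s} → ⦅-to c⊏a′ a′⊏d c⊏a a⊏d s)

    strict-vs-weak : ∀ {a} → c ⊏ a → a ⊏ d → (⊢⦅ a) ⊆ (⊢[ a) × (⊢[ a) ᶠ ≐ (⊢⦅ a) ᶠ
    strict-vs-weak c⊏a a⊏d =
        (λ {s} → ⦅⊆[ c⊏a a⊏d s)
      , ((λ {s} → [ᶠ⊆⦅ᶠ c⊏a a⊏d s) , λ {s} → ⦅ᶠ⊆[ᶠ c⊏a a⊏d s)

  -- Separating sequents

  ½⊑⇒⊖⊑ : ½ℝ ⊑ x → ⊖ x ⊑ x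
  ½⊑⇒⊖⊑ ½⊑x = ⊑-trans (⊖-antitone ½⊑x) (⊑-trans (proj₁ ⊖½≈½) ½⊑x)

  ⊑½⇒⊑⊖ : x ⊑ ½ℝ → x ⊑ ⊖ x
  ⊑½⇒⊑⊖ x⊑½ = ⊑-trans x⊑½ (⊑-trans (proj₂ ⊖½≈½) (⊖-antitone x⊑½))

  ⊏½⇒⊏⊖ : x ⊏ ½ℝ → x ⊏ ⊖ x
  ⊏½⇒⊏⊖ x⊏½ = ⊏-trans x⊏½ (½⊏⊖ x⊏½)

  ½⊏⇒⊖⊏ : ½ℝ ⊏ x → ⊖ x ⊏ x
  ½⊏⇒⊖⊏ ½⊏x = ⊏-trans (⊖⊏½ ½⊏x) ½⊏x

  point : ∀ {c d} → 0ℝ ⊑ c → c ⊏ d → d ⊑ 1ℝ → ∃[ x ] c ⊏ val x × val x ⊏ d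
  point 0⊑c c⊏d d⊑1 =
    let q , c⊏q , q⊏d = ⊏-dense c⊏d
    in mk𝕀 (fromℚ q) (⊑-out (⊑-trans 0⊑c (⊏⇒⊑ c⊏q))) (⊑-out (⊑-trans (⊏⇒⊑ q⊏d) d⊑1))
     , c⊏q , q⊏d

  -- Opaque copies of the operations, so that comparing values of formulas
  -- does not unfold them to cuts.
  infixr 7 _⋏_
  infixr 6 _⇛_

  opaque
    unfolding ⊖_

    𝟘 𝟙 half : 𝕀
    𝟘 = 𝕀-zero
    𝟙 = 𝕀-one
    half = mk𝕀 ½ℝ (⊑-out (⊏⇒⊑ 0⊏½)) (⊑-out (⊏⇒⊑ ½⊏1))

    neg : 𝕀 → 𝕀
    neg = 𝕀-neg

    _⋏_ _⇛_ : 𝕀 → 𝕀 → 𝕀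
    _⋏_ = _⊓_
    _⇛_ = _⇒_

    val-𝟘 : val 𝟘 ≡ 0ℝ
    val-𝟘 = refl

    val-𝟙 : val 𝟙 ≡ 1ℝ
    val-𝟙 = refl

    val-half : val half ≡ ½ℝ
    val-half = refl

    val-neg : ∀ x → val (neg x) ≡ ⊖ val x
    val-neg x = refl

    ⋏-left : ∀ x y → val x ⊑ val y → x ⋏ y ≡ x
    ⋏-left = ⊓-left

    ⋏-right : ∀ x y → ¬ val x ⊑ val y → x ⋏ y ≡ y
    ⋏-right = ⊓-right

    ⇛-one : ∀ x y → val x ⊑ val y → x ⇛ y ≡ 𝟙
    ⇛-one = ⇒-one

    ⇛-right : ∀ x y → ¬ val x ⊑ val y → x ⇛ y ≡ y
    ⇛-right = ⇒-right

  eval : Fm → (ℕ → 𝕀) → 𝕀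
  eval (var i)  v = v i
  eval ⊥̇        v = 𝟘
  eval (φ ∧̇ ψ)  v = eval φ v ⋏ eval ψ v
  eval (φ →̇ ψ)  v = eval φ v ⇛ eval ψ v
  eval (∼̇ φ)    v = neg (eval φ v)

  opaque
    unfolding 𝟘

    eval≡⟦⟧ : ∀ φ v → eval φ v ≡ ⟦ φ ⟧ v
    eval≡⟦⟧ (var i)  v = refl
    eval≡⟦⟧ ⊥̇        v = refl
    eval≡⟦⟧ (φ ∧̇ ψ)  v = cong₂ _⊓_ (eval≡⟦⟧ φ v) (eval≡⟦⟧ ψ v)
    eval≡⟦⟧ (φ →̇ ψ)  v = cong₂ _⇒_ (eval≡⟦⟧ φ v) (eval≡⟦⟧ ψ v)
    eval≡⟦⟧ (∼̇ φ)    v = cong 𝕀-neg (eval≡⟦⟧ φ v)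

  neg-val : (P : ℝ → Set) → ∀ {x} → P (⊖ val x) → P (val (neg x))
  neg-val P = subst P (sym (val-neg _))

  neg-val⁻¹ : (P : ℝ → Set) → ∀ {x} → P (val (neg x)) → P (⊖ val x)
  neg-val⁻¹ P = subst P (val-neg _)

  x⋏neg⊑½ : ∀ x → val (x ⋏ neg x) ⊑ ½ℝ
  x⋏neg⊑½ x = case em {val x ⊑ val (neg x)} of λ where
    (yes x⊑⊖x) → subst (λ y → val y ⊑ ½ℝ) (sym (⋏-left x (neg x) x⊑⊖x))
      (⊏̸⇒⊒ λ ½⊏x → ⊏⇒⋣ (½⊏⇒⊖⊏ ½⊏x) (neg-val⁻¹ (val x ⊑_) x⊑⊖x))
    (no ¬x⊑⊖x) → subst (λ y → val y ⊑ ½ℝ) (sym (⋏-right x (neg x) ¬x⊑⊖x))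
      (neg-val (_⊑ ½ℝ) (⊏̸⇒⊒ λ ½⊏⊖x → ¬x⊑⊖x (neg-val (val x ⊑_)
        (⊑½⇒⊑⊖ (⊑-trans (proj₂ ⊖-involutive) (⊏⇒⊑ (⊖⊏½ ½⊏⊖x)))))))

  half⋏neg : half ⋏ neg half ≡ half
  half⋏neg = ⋏-left half (neg half) (neg-val (val half ⊑_) (⊑½⇒⊑⊖ (subst (_⊑ ½ℝ) (sym val-half) ⊑-refl)))

  Sequent : Set₁
  Sequent = Pred Fm 0ℓ × Fm

  _⊦_ : List Fm → Fm → Sequent
  Γ ⊦ φ = (_∈ˡ Γ) , φ

  X : Fm
  X = var 0

  ¬̇_ : Fm → Fm
  ¬̇ φ = φ →̇ ⊥̇

  -- As `X ∧̇ ∼̇ X` takes exactly the values in [0,½], the first two test on which side of the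
  -- filter's boundary ½ lies. The third is the rule from `X` to Δ`X`, singling out {1}. The last
  -- three detect filters containing (½,1], contained in [½,1], and equal to (0,1].
  excludedMiddle explosion necessitation aboveHalf belowHalf stability : Sequent
  excludedMiddle = [] ⊦ (∼̇ (X ∧̇ ∼̇ X))
  explosion      = (X ∧̇ ∼̇ X ∷ []) ⊦ ⊥̇
  necessitation  = (X ∷ []) ⊦ (¬̇ (∼̇ X))
  -- The premise is 1 for x > ½, and x itself for x ≤ ½.
  aboveHalf      = ((X →̇ ∼̇ X) →̇ X ∷ []) ⊦ X
  -- The conclusion is 0 for x < ½, and x itself for x ≥ ½.
  belowHalf      = (X ∷ []) ⊦ (∼̇ ((∼̇ X →̇ X) →̇ ∼̇ X))
  stability      = (¬̇ (¬̇ X) ∷ []) ⊦ X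

  module _ (F : Pred 𝕀 0ℓ) where

    valid : ∀ γ φ → (∀ v → F (eval γ v) → F (eval φ v)) → ((γ ∷ []) ⊦ φ) ∈ logicOf F
    valid γ φ h v Γ∈F = subst F (eval≡⟦⟧ φ v) (h v (subst F (sym (eval≡⟦⟧ γ v)) (Γ∈F (here refl))))

    invalid : ∀ γ φ v → F (eval γ v) → ¬ F (eval φ v) → ((γ ∷ []) ⊦ φ) ∉ logicOf F
    invalid γ φ v Fγ ¬Fφ s = ¬Fφ (subst F (sym (eval≡⟦⟧ φ v))
      (s v λ { (here refl) → subst F (eval≡⟦⟧ γ v) Fγ }))

    excludedMiddle-valid : (∀ x → ½ℝ ⊑ val x → F x) → excludedMiddle ∈ logicOf F
    excludedMiddle-valid F-½ v _ = subst F (eval≡⟦⟧ (∼̇ (X ∧̇ ∼̇ X)) v)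
      (F-½ _ (neg-val (½ℝ ⊑_) (⊑-trans (proj₂ ⊖½≈½) (⊖-antitone (x⋏neg⊑½ (v 0))))))

    excludedMiddle-invalid : (∀ x → F x → ½ℝ ⊏ val x) → excludedMiddle ∉ logicOf F
    excludedMiddle-invalid F-½ s = ⊏⇒⋣ ½⊏⊖half (proj₁ ⊖½≈½)
      where
      ½⊏⊖half : ½ℝ ⊏ ⊖ ½ℝ
      ½⊏⊖half = subst (λ y → ½ℝ ⊏ ⊖ y) val-half (neg-val⁻¹ (½ℝ ⊏_)
        (subst (λ y → ½ℝ ⊏ val (neg y)) half⋏neg
          (F-½ _ (subst F (sym (eval≡⟦⟧ (∼̇ (X ∧̇ ∼̇ X)) (const half))) (s (const half) λ ())))))

    -- Vacuous: the premise never exceeds ½.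
    explosion-valid : (∀ x → F x → ½ℝ ⊏ val x) → explosion ∈ logicOf F
    explosion-valid F-½ = valid (X ∧̇ ∼̇ X) ⊥̇ λ v Fx →
      ⊥-elim (⊏⇒⋣ (F-½ _ Fx) (x⋏neg⊑½ (v 0)))

    explosion-invalid : F half → ¬ F 𝟘 → explosion ∉ logicOf F
    explosion-invalid F½ = invalid (X ∧̇ ∼̇ X) ⊥̇ (const half) (subst F (sym half⋏neg) F½)

    necessitation-valid : F 𝟙 → (∀ x → F x → 1ℝ ⊑ val x) → necessitation ∈ logicOf F
    necessitation-valid F1 F⊑1 = valid X (¬̇ (∼̇ X)) λ v Fx → subst F
      (sym (⇛-one (neg (v 0)) 𝟘 (subst (val (neg (v 0)) ⊑_) (sym val-𝟘)
        (neg-val (_⊑ 0ℝ) (⊑-trans (⊖-antitone (F⊑1 _ Fx)) (proj₁ ⊖1≈0))))))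
      F1

    -- A designated value below 1 has nonzero `∼̇`, so the conclusion drops to 0.
    necessitation-invalid : ¬ F 𝟘 → ∀ x → F x → val x ⊏ 1ℝ → necessitation ∉ logicOf F
    necessitation-invalid ¬F0 x Fx x⊏1 = invalid X (¬̇ (∼̇ X)) (const x) Fx (¬F0 ∘ subst F
      (⇛-right (neg x) 𝟘 (⊏⇒⋣ (subst (_⊏ val (neg x)) (sym val-𝟘)
        (neg-val (0ℝ ⊏_) (⊑-⊏-trans (proj₂ ⊖1≈0) (⊖-strict x⊏1)))))))

    aboveHalf-valid : (∀ x → ½ℝ ⊏ val x → F x) → aboveHalf ∈ logicOf F
    aboveHalf-valid F-½ = valid ((X →̇ ∼̇ X) →̇ X) X λ v → go (v 0) em
      where
      go : ∀ x → Dec (val x ⊑ ½ℝ) → F ((x ⇛ neg x) ⇛ x) → F x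
      go x (no ¬x⊑½) _ = F-½ x (⋢⇒⊐ ¬x⊑½)
      go x (yes x⊑½) = subst F (trans
        (cong (_⇛ x) (⇛-one x (neg x) (neg-val (val x ⊑_) (⊑½⇒⊑⊖ x⊑½))))
        (⇛-right 𝟙 x (⊏⇒⋣ (subst (val x ⊏_) (sym val-𝟙) (⊑-⊏-trans x⊑½ ½⊏1)))))

    aboveHalf-invalid : F 𝟙 → ∀ x → ¬ F x → ½ℝ ⊏ val x → aboveHalf ∉ logicOf F
    aboveHalf-invalid F1 x ¬Fx ½⊏x = invalid ((X →̇ ∼̇ X) →̇ X) X (const x)
      (subst F (sym (trans
        (cong (_⇛ x) (⇛-right x (neg x) (⊏⇒⋣ ⊖x⊏x)))
        (⇛-one (neg x) x (⊏⇒⊑ ⊖x⊏x)))) F1)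
      ¬Fx
      where
      ⊖x⊏x : val (neg x) ⊏ val x
      ⊖x⊏x = neg-val (_⊏ val x) (½⊏⇒⊖⊏ ½⊏x)

    belowHalf-valid : (∀ x → F x → ½ℝ ⊑ val x) → (∀ x y → F x → val x ⊑ val y → F y) →
      belowHalf ∈ logicOf F
    belowHalf-valid F-½ F-up = valid X (∼̇ ((∼̇ X →̇ X) →̇ ∼̇ X)) λ v Fx →
      subst (λ y → F (neg (y ⇛ neg (v 0))))
        (sym (⇛-one (neg (v 0)) (v 0) (neg-val (_⊑ val (v 0)) (½⊑⇒⊖⊑ (F-½ _ Fx)))))
        (F-up _ _ Fx (neg-val (val (v 0) ⊑_)
          (⊑-trans (proj₂ ⊖-involutive)
            (⊖-antitone (neg-val⁻¹ (val (𝟙 ⇛ neg (v 0)) ⊑_) (𝟙⇛ (neg (v 0))))))))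
      where
      -- This inequality at ∼x puts the conclusion at or above x, and upward closure of `F` does the
      -- rest.
      𝟙⇛ : ∀ y → val (𝟙 ⇛ y) ⊑ val y
      𝟙⇛ y = case em {val 𝟙 ⊑ val y} of λ where
        (yes 1⊑y) → subst (λ z → val z ⊑ val y) (sym (⇛-one 𝟙 y 1⊑y)) 1⊑y
        (no ¬1⊑y) → subst (λ z → val z ⊑ val y) (sym (⇛-right 𝟙 y ¬1⊑y)) ⊑-refl

    belowHalf-invalid : (∀ x → F x → 0ℝ ⊏ val x) → ∀ x → F x → val x ⊏ ½ℝ → belowHalf ∉ logicOf F
    belowHalf-invalid F-0 x Fx x⊏½ = invalid X (∼̇ ((∼̇ X →̇ X) →̇ ∼̇ X)) (const x) Fx λ Fφ →
      ⊏⇒⋣ (subst (λ y → 0ℝ ⊏ ⊖ y) val-𝟙 (neg-val⁻¹ (0ℝ ⊏_) (F-0 _ (subst (F ∘ neg) (trans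
        (cong (_⇛ neg x) (⇛-right (neg x) x (⊏⇒⋣ x⊏⊖x)))
        (⇛-one x (neg x) (⊏⇒⊑ x⊏⊖x))) Fφ))))
      (proj₁ ⊖1≈0)
      where
      x⊏⊖x : val x ⊏ val (neg x)
      x⊏⊖x = neg-val (val x ⊏_) (⊏½⇒⊏⊖ x⊏½)

    stability-valid : ¬ F 𝟘 → (∀ x → 0ℝ ⊏ val x → F x) → stability ∈ logicOf F
    stability-valid ¬F0 F-0 = valid (¬̇ (¬̇ X)) X λ v → go (v 0) em
      where
      𝟘⊏𝟙 : val 𝟘 ⊏ val 𝟙
      𝟘⊏𝟙 = subst₂ _⊏_ (sym val-𝟘) (sym val-𝟙) 0⊏1
      go : ∀ x → Dec (val x ⊑ val 𝟘) → F ((x ⇛ 𝟘) ⇛ 𝟘) → F x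
      go x (no ¬x⊑0) _ = F-0 x (subst (_⊏ val x) val-𝟘 (⋢⇒⊐ ¬x⊑0))
      go x (yes x⊑0) Fγ = ⊥-elim (¬F0 (subst F (trans
        (cong (_⇛ 𝟘) (⇛-one x 𝟘 x⊑0))
        (⇛-right 𝟙 𝟘 (⊏⇒⋣ 𝟘⊏𝟙))) Fγ))

    stability-invalid : F 𝟙 → ∀ x → ¬ F x → 0ℝ ⊏ val x → stability ∉ logicOf F
    stability-invalid F1 x ¬Fx 0⊏x = invalid (¬̇ (¬̇ X)) X (const x)
      (subst F (sym (trans
        (cong (_⇛ 𝟘) (⇛-right x 𝟘 (⊏⇒⋣ (subst (_⊏ val x) (sym val-𝟘) 0⊏x))))
        (⇛-one 𝟘 𝟘 ⊑-refl))) F1)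
      ¬Fx

  -- The six sequents at particular thresholds.

  finitary : ∀ F Γ φ → (Γ ⊦ φ) ∈ logicOf F → (Γ ⊦ φ) ∈ (logicOf F) ᶠ
  finitary F Γ φ s = Γ , All.tabulate id , s

  separate : ∀ (A B : Logic) s → s ∈ A → s ∉ B → A ⊈ B
  separate _ _ s s∈A s∉B A⊆B = s∉B (A⊆B {s} s∈A)

  ≤-one : x ⊑ 1ℝ → 𝟙 ∈ [ x ,1]
  ≤-one {x} x⊑1 = ⊑-out (subst (x ⊑_) (sym val-𝟙) x⊑1)

  <-one : x ⊏ 1ℝ → 𝟙 ∈ ⦅ x ,1]
  <-one {x} x⊏1 = ⊏-out (subst (x ⊏_) (sym val-𝟙) x⊏1)

  ≰-zero : 0ℝ ⊏ x → 𝟘 ∉ [ x ,1]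
  ≰-zero {x} 0⊏x p = ⊏⇒⋣ 0⊏x (subst (x ⊑_) val-𝟘 (⊑-in p))

  ≮-zero : 0ℝ ⊑ x → 𝟘 ∉ ⦅ x ,1]
  ≮-zero {x} 0⊑x p = ⊏⇒⋣ (subst (x ⊏_) val-𝟘 (⊏-in p)) 0⊑x

  ≤-half : x ⊑ ½ℝ → half ∈ [ x ,1]
  ≤-half {x} x⊑½ = ⊑-out (subst (x ⊑_) (sym val-half) x⊑½)

  <-half : x ⊏ ½ℝ → half ∈ ⦅ x ,1]
  <-half {x} x⊏½ = ⊏-out (subst (x ⊏_) (sym val-half) x⊏½)

  excludedMiddle∈[ : ∀ x → x ⊑ ½ℝ → excludedMiddle ∈ ⊢[ x
  excludedMiddle∈[ x x⊑½ = excludedMiddle-valid [ x ,1] λ _ ½⊑y → ⊑-out (⊑-trans x⊑½ ½⊑y)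

  excludedMiddle∉[ : ∀ x → ½ℝ ⊏ x → excludedMiddle ∉ ⊢[ x
  excludedMiddle∉[ x ½⊏x = excludedMiddle-invalid [ x ,1] λ _ x≤y → ⊏-⊑-trans ½⊏x (⊑-in x≤y)

  excludedMiddle∉⦅½ : excludedMiddle ∉ ⊢⦅ ½ℝ
  excludedMiddle∉⦅½ = excludedMiddle-invalid ⦅ ½ℝ ,1] λ _ → ⊏-in

  explosion∈[ : ∀ x → ½ℝ ⊏ x → explosion ∈ ⊢[ x
  explosion∈[ x ½⊏x = explosion-valid [ x ,1] λ _ x≤y → ⊏-⊑-trans ½⊏x (⊑-in x≤y)

  explosion∈⦅½ : explosion ∈ ⊢⦅ ½ℝ
  explosion∈⦅½ = explosion-valid ⦅ ½ℝ ,1] λ _ → ⊏-in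

  explosion∉[ : ∀ x → 0ℝ ⊏ x → x ⊑ ½ℝ → explosion ∉ ⊢[ x
  explosion∉[ x 0⊏x x⊑½ = explosion-invalid [ x ,1] (≤-half x⊑½) (≰-zero 0⊏x)

  explosion∉⦅0 : explosion ∉ ⊢⦅ 0ℝ
  explosion∉⦅0 = explosion-invalid ⦅ 0ℝ ,1] (<-half 0⊏½) (≮-zero ⊑-refl)

  necessitation∈₁ : necessitation ∈ ⊢₁
  necessitation∈₁ = necessitation-valid [ 1ℝ ,1] (≤-one ⊑-refl) λ _ → ⊑-in

  necessitation∉[ : ∀ x → 0ℝ ⊏ x → x ⊏ 1ℝ → necessitation ∉ ⊢[ x
  necessitation∉[ x 0⊏x x⊏1 =
    let y , x⊏y , y⊏1 = point (⊏⇒⊑ 0⊏x) x⊏1 ⊑-refl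
    in necessitation-invalid [ x ,1] (≰-zero 0⊏x) y (⊑-out (⊏⇒⊑ x⊏y)) y⊏1

  aboveHalf∈⦅½ : aboveHalf ∈ ⊢⦅ ½ℝ
  aboveHalf∈⦅½ = aboveHalf-valid ⦅ ½ℝ ,1] λ _ → ⊏-out

  aboveHalf∉[ : ∀ x → ½ℝ ⊏ x → x ⊑ 1ℝ → aboveHalf ∉ ⊢[ x
  aboveHalf∉[ x ½⊏x x⊑1 =
    let y , ½⊏y , y⊏x = point (⊏⇒⊑ 0⊏½) ½⊏x x⊑1
    in aboveHalf-invalid [ x ,1] (≤-one x⊑1) y (⊏⇒⋣ y⊏x ∘ ⊑-in) ½⊏y

  belowHalf∈[½ : belowHalf ∈ ⊢[ ½ℝ
  belowHalf∈[½ = belowHalf-valid [ ½ℝ ,1] (λ _ → ⊑-in) λ x _ ½≤x x⊑y →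
    ⊑-out (⊑-trans (⊑-in {½ℝ} {val x} ½≤x) x⊑y)

  belowHalf∉[ : ∀ x → 0ℝ ⊏ x → x ⊏ ½ℝ → belowHalf ∉ ⊢[ x
  belowHalf∉[ x 0⊏x x⊏½ =
    let y , x⊏y , y⊏½ = point (⊏⇒⊑ 0⊏x) x⊏½ (⊏⇒⊑ ½⊏1)
    in belowHalf-invalid [ x ,1] (λ _ x≤z → ⊏-⊑-trans 0⊏x (⊑-in x≤z)) y (⊑-out (⊏⇒⊑ x⊏y)) y⊏½

  belowHalf∉⦅0 : belowHalf ∉ ⊢⦅ 0ℝ
  belowHalf∉⦅0 =
    let y , 0⊏y , y⊏½ = point ⊑-refl 0⊏½ (⊏⇒⊑ ½⊏1)
    in belowHalf-invalid ⦅ 0ℝ ,1] (λ _ → ⊏-in) y (⊏-out 0⊏y) y⊏½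

  stability∈⦅0 : stability ∈ ⊢⦅ 0ℝ
  stability∈⦅0 = stability-valid ⦅ 0ℝ ,1] (≮-zero ⊑-refl) λ _ → ⊏-out

  stability∉[ : ∀ x → 0ℝ ⊏ x → x ⊑ 1ℝ → stability ∉ ⊢[ x
  stability∉[ x 0⊏x x⊑1 =
    let y , 0⊏y , y⊏x = point ⊑-refl 0⊏x x⊑1
    in stability-invalid [ x ,1] (≤-one x⊑1) y (⊏⇒⋣ y⊏x ∘ ⊑-in) 0⊏y

  stability∉⦅½ : stability ∉ ⊢⦅ ½ℝ
  stability∉⦅½ =
    let y , 0⊏y , y⊏½ = point ⊑-refl 0⊏½ (⊏⇒⊑ ½⊏1)
    in stability-invalid ⦅ ½ℝ ,1] (<-one ½⊏1) y (λ p → ⊏⇒⋣ y⊏½ (⊏⇒⊑ (⊏-in p))) 0⊏y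

  -- The intervals (½,1) and (0,½), and assembly of the claims.

  module Positive = Homogeneous ½⊏1 moving⁺
  module Negative = Homogeneous 0⊏½ moving⁻

proposition1 : (em : ExcludedMiddle 0ℓ) →
    let open StandardAlgebra em
        Pos = ⦅ ½ℝ , 1ℝ ⦆
        Neg = ⦅ 0ℝ , ½ℝ ⦆
    in
      -- P1
      ( (∀ p p′ → p ∈ Pos → p′ ∈ Pos → (⊢[ p) ≐ (⊢[ p′) × (⊢⦅ p) ≐ (⊢⦅ p′))
      × (∀ p → p ∈ Pos → (⊢⦅ p) ⊆ (⊢[ p) × (⊢[ p) ᶠ ≐ (⊢⦅ p) ᶠ) )
      -- P2
    × ( (∀ n n′ → n ∈ Neg → n′ ∈ Neg → (⊢[ n) ≐ (⊢[ n′) × (⊢⦅ n) ≐ (⊢⦅ n′))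
      × (∀ n → n ∈ Neg → (⊢⦅ n) ⊆ (⊢[ n) × (⊢[ n) ᶠ ≐ (⊢⦅ n) ᶠ) )
      -- P3
    × (∀ p → p ∈ Pos → (⊢[ p) ⊂ ⊢₁)
      -- P4
    × Incomparable ⊢₁ (⊢[ ½ℝ)
      -- P5
    × (∀ p → p ∈ Pos → Incomparable (⊢[ p) (⊢[ ½ℝ) × Incomparable ((⊢[ p) ᶠ) (⊢[ ½ℝ))
      -- P6
    × (∀ p → p ∈ Pos → (⊢[ p) ᶠ ⊂ (⊢⦅ ½ℝ))
      -- P7
    × (∀ p n → p ∈ Pos → n ∈ Neg → Incomparable (⊢[ p) (⊢[ n) × Incomparable ((⊢[ p) ᶠ) ((⊢[ n) ᶠ))
      -- P8
    × (∀ n → n ∈ Neg → (⊢[ n) ⊂ (⊢[ ½ℝ))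
      -- P9
    × ( Incomparable (⊢⦅ 0ℝ) (⊢[ ½ℝ) × Incomparable (⊢⦅ 0ℝ) (⊢⦅ ½ℝ)
      × Incomparable (⊢[ ½ℝ) (⊢⦅ ½ℝ) )
      -- P10
    × (∀ n → n ∈ Neg → (⊢[ n) ᶠ ⊂ (⊢⦅ 0ℝ))
proposition1 em =
    ( (λ p p′ (½<p , p<1) (½<p′ , p′<1) →
        Positive.thresholds-irrelevant {p} {p′} (⊏-in ½<p) (⊏-in p<1) (⊏-in ½<p′) (⊏-in p′<1))
    , (λ p (½<p , p<1) → Positive.strict-vs-weak {p} (⊏-in ½<p) (⊏-in p<1)) )
  , ( (λ n n′ (0<n , n<½) (0<n′ , n′<½) →
        Negative.thresholds-irrelevant {n} {n′} (⊏-in 0<n) (⊏-in n<½) (⊏-in 0<n′) (⊏-in n′<½))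
    , (λ n (0<n , n<½) → Negative.strict-vs-weak {n} (⊏-in 0<n) (⊏-in n<½)) )
  , (λ p (½<p , p<1) →
        (λ {s} → Positive.[⊆[sup {p} (⊏-in ½<p) (⊏-in p<1) s)
      , separate ⊢₁ (⊢[ p) necessitation necessitation∈₁
          (necessitation∉[ p (⊏-trans 0⊏½ (⊏-in ½<p)) (⊏-in p<1)))
  , ( separate ⊢₁ (⊢[ ½ℝ) necessitation necessitation∈₁ (necessitation∉[ ½ℝ 0⊏½ ½⊏1)
    , separate (⊢[ ½ℝ) ⊢₁ excludedMiddle (excludedMiddle∈[ ½ℝ ⊑-refl) (excludedMiddle∉[ 1ℝ ½⊏1) )
  , (λ p (½<p , p<1) →
        ( separate (⊢[ p) (⊢[ ½ℝ) explosion (explosion∈[ p (⊏-in ½<p)) (explosion∉[ ½ℝ 0⊏½ ⊑-refl)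
        , separate (⊢[ ½ℝ) (⊢[ p) excludedMiddle (excludedMiddle∈[ ½ℝ ⊑-refl)
            (excludedMiddle∉[ p (⊏-in ½<p)) )
      , ( separate ((⊢[ p) ᶠ) (⊢[ ½ℝ) explosion
            (finitary [ p ,1] (X ∧̇ ∼̇ X ∷ []) ⊥̇ (explosion∈[ p (⊏-in ½<p))) (explosion∉[ ½ℝ 0⊏½ ⊑-refl)
        , separate (⊢[ ½ℝ) ((⊢[ p) ᶠ) excludedMiddle (excludedMiddle∈[ ½ℝ ⊑-refl)
            (excludedMiddle∉[ p (⊏-in ½<p) ∘ ᶠ⊆ [ p ,1] excludedMiddle) ))
  , (λ p (½<p , p<1) →
        (λ {s} → Positive.[ᶠ⊆⦅inf {p} (⊏-in ½<p) (⊏-in p<1) s)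
      , separate (⊢⦅ ½ℝ) ((⊢[ p) ᶠ) aboveHalf aboveHalf∈⦅½
          (aboveHalf∉[ p (⊏-in ½<p) (⊏⇒⊑ (⊏-in p<1)) ∘ ᶠ⊆ [ p ,1] aboveHalf))
  , (λ p n (½<p , p<1) (0<n , n<½) →
      let explosion∈p = explosion∈[ p (⊏-in ½<p)
          explosion∉n = explosion∉[ n (⊏-in 0<n) (⊏⇒⊑ (⊏-in n<½))
          excludedMiddle∈n = excludedMiddle∈[ n (⊏⇒⊑ (⊏-in n<½))
          excludedMiddle∉p = excludedMiddle∉[ p (⊏-in ½<p)
      in
        ( separate (⊢[ p) (⊢[ n) explosion explosion∈p explosion∉n
        , separate (⊢[ n) (⊢[ p) excludedMiddle excludedMiddle∈n excludedMiddle∉p )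
      , ( separate ((⊢[ p) ᶠ) ((⊢[ n) ᶠ) explosion
            (finitary [ p ,1] (X ∧̇ ∼̇ X ∷ []) ⊥̇ explosion∈p)
            (explosion∉n ∘ ᶠ⊆ [ n ,1] explosion)
        , separate ((⊢[ n) ᶠ) ((⊢[ p) ᶠ) excludedMiddle
            (finitary [ n ,1] [] (∼̇ (X ∧̇ ∼̇ X)) excludedMiddle∈n)
            (excludedMiddle∉p ∘ ᶠ⊆ [ p ,1] excludedMiddle) ))
  , (λ n (0<n , n<½) →
        (λ {s} → Negative.[⊆[sup {n} (⊏-in 0<n) (⊏-in n<½) s)
      , separate (⊢[ ½ℝ) (⊢[ n) belowHalf belowHalf∈[½ (belowHalf∉[ n (⊏-in 0<n) (⊏-in n<½)))
  , ( ( separate (⊢⦅ 0ℝ) (⊢[ ½ℝ) stability stability∈⦅0 (stability∉[ ½ℝ 0⊏½ (⊏⇒⊑ ½⊏1))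
      , separate (⊢[ ½ℝ) (⊢⦅ 0ℝ) belowHalf belowHalf∈[½ belowHalf∉⦅0 )
    , ( separate (⊢⦅ 0ℝ) (⊢⦅ ½ℝ) stability stability∈⦅0 stability∉⦅½
      , separate (⊢⦅ ½ℝ) (⊢⦅ 0ℝ) explosion explosion∈⦅½ explosion∉⦅0 )
    , ( separate (⊢[ ½ℝ) (⊢⦅ ½ℝ) excludedMiddle (excludedMiddle∈[ ½ℝ ⊑-refl) excludedMiddle∉⦅½
      , separate (⊢⦅ ½ℝ) (⊢[ ½ℝ) explosion explosion∈⦅½ (explosion∉[ ½ℝ 0⊏½ ⊑-refl) ) )
  , (λ n (0<n , n<½) →
        (λ {s} → Negative.[ᶠ⊆⦅inf {n} (⊏-in 0<n) (⊏-in n<½) s)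
      , separate (⊢⦅ 0ℝ) ((⊢[ n) ᶠ) stability stability∈⦅0
          (stability∉[ n (⊏-in 0<n) (⊏⇒⊑ (⊏-trans (⊏-in n<½) ½⊏1)) ∘ ᶠ⊆ [ n ,1] stability))
  where
  open StandardAlgebra em
  open Classical em
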